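{- Let $\mathbf{d}=d_0d_1d_2\cdots\in\{ -1,1\}^{\infty}$. Then $\mathbf{d}$ is apwenian if and only if \[\forall\, n\geq 0,\quad \frac{d_n+d_{n+1}-d_{2n+1}-d_{2n+2}}{2}\equiv 1\pmod{2}.\]
   Context: For a sequence $\mathbf{a}=a_0a_1a_2\cdots$ of integers and $n\geq 1$, the Hankel determinant of order $n$ is $H_n(\mathbf{a})=\det(a_{i+j})_{0\leq i,j\leq n-1}$. A sequence $\mathbf{d}\in\{ -1,1\}^{\infty}$ is called apwenian if for all $n\geq 1$, $H_n(\mathbf{d})/2^{n-1}\equiv 1\pmod 2$. -}

module Defs where

open import Data.Nat as ℕ using (ℕ; zero; suc)
open import Data.Fin using (Fin; zero; suc; toℕ; punchIn)
open import Data.Integer using (ℤ; +_; -_; _+_; _-_; _*_; -1ℤ; 1ℤ)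
open import Data.Product using (∃; _×_)
open import Data.Sum using (_⊎_)
open import Relation.Binary.PropositionalEquality using (_≡_)

∑ : (n : ℕ) → (Fin n → ℤ) → ℤ
∑ zero    f = + 0
∑ (suc n) f = f zero + ∑ n (λ i → f (suc i))

sgn : ℕ → ℤ
sgn zero = 1ℤ
sgn (suc k) = - sgn k

det : (n : ℕ) → (Fin n → Fin n → ℤ) → ℤ
det zero    M = 1ℤ
det (suc n) M =
  ∑ (suc n) (λ j → sgn (toℕ j) * M zero j * det n (λ r c → M (suc r) (punchIn j c)))

hankel : (ℕ → ℤ) → ℕ → ℤ
hankel a n = det n (λ i j → a (toℕ i ℕ.+ toℕ j))

IsPM1Seq : (ℕ → ℤ) → Set
IsPM1Seq d = ∀ n → (d n ≡ 1ℤ) ⊎ (d n ≡ -1ℤ)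

-- "x / 2^m ≡ 1 (mod 2)": x = 2^m * (odd integer)
OddMultipleOf2^ : ℕ → ℤ → Set
OddMultipleOf2^ m x = ∃ λ (k : ℤ) → x ≡ (+ (2 ℕ.^ m)) * (+ 2 * k + 1ℤ)

-- apwenian: for all n ≥ 1, H_n(d) / 2^(n-1) ≡ 1 (mod 2)
Apwenian : (ℕ → ℤ) → Set
Apwenian d = ∀ (n : ℕ) → OddMultipleOf2^ n (hankel d (suc n))

{-# OPTIONS --safe #-}
module Submission where

-- Write d_n = (-1)^{x_n}. The Schur complement of the top left entry of the Hankel
-- matrix of d has even entries, hence H_{n+1}(d) = ± 2^n det C with
-- C_{ij} ≡ x_{i+j+2} + x_{i+1} + x_0 + x_{j+1} (mod 2). Over 𝔽₂ the matrix C is the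
-- Bézoutian of the series u = 1 + t + t² + ⋯ and v = Σ C_{0j} t^j. The Schur complement
-- of the Bézoutian of (u, v) is the Bézoutian of (v, w), where u = (1 + a t) v + t² w is
-- one step of the Euclidean algorithm. The form Q(u, v) = u² + (1 + t) u v + t² v² satisfies
-- Q(u, v) = (1 + a) t v² + t² Q(v, w), so a step merely shifts its even-index coefficients
-- q_0, q_1, …. Therefore, if q_i = 0 for all i < n, the minor of order n + 1 is 1 + q_n.
-- For the initial pair, q_n = 1 + x_n + x_{n+1} + x_{2n+1} + x_{2n+2}.

open import Defs
open import Data.Nat using (ℕ; _+_; _*_)
open import Data.Integer using (ℤ) renaming (_+_ to _+ℤ_; _-_ to _-ℤ_)
open import Function.Bundles using (_⇔_)

import Algebra.Solver.Ring.AlmostCommutativeRing as ACR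
import Algebra.Solver.Ring.Simple as RingSolver
open import Data.Fin using (Fin; zero; suc; toℕ; punchIn)
import Data.Integer as ℤ
open import Data.Integer using (+_; -[1+_]; -_; ∣_∣; 0ℤ; 1ℤ; -1ℤ; _⊖_) renaming (_*_ to infixl 7 _*ℤ_)
import Data.Integer.Properties as ℤₚ
open import Data.Integer.Tactic.RingSolver using (solve-∀)
open import Data.Nat using (zero; suc; _<_; _^_; parity; z<s; s<s)
import Data.Nat.Properties as ℕₚ
open import Data.Parity.Base using (Parity; 0ℙ; 1ℙ; _⁻¹) renaming (_+_ to infixl 6 _⊕_; _*_ to infixl 7 _⊗_)
import Data.Parity.Properties as ℙₚ
open import Data.Product using (∃; _×_; _,_; proj₁; proj₂)
open import Data.Sum using (inj₁; inj₂)
open import Data.Unit using (⊤; tt)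
open import Function.Base using (_∘_)
open import Function.Bundles using (mk⇔; Equivalence)
open import Relation.Binary.PropositionalEquality

module ℙ-Solver = RingSolver (ACR.fromCommutativeRing ℙₚ.+-*-commutativeRing) ℙₚ._≟_

-- Finite sums and determinants over ℤ

∑-cong : ∀ n {f g : Fin n → ℤ} → (∀ i → f i ≡ g i) → ∑ n f ≡ ∑ n g
∑-cong zero    f≗g = refl
∑-cong (suc n) f≗g = cong₂ _+ℤ_ (f≗g zero) (∑-cong n (f≗g ∘ suc))

∑-linear : ∀ n a b (f g : Fin n → ℤ) →
           ∑ n (λ i → a *ℤ f i +ℤ b *ℤ g i) ≡ a *ℤ ∑ n f +ℤ b *ℤ ∑ n g
∑-linear zero    a b f g = lemma a b
  where
  lemma : ∀ a b → + 0 ≡ a *ℤ + 0 +ℤ b *ℤ + 0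
  lemma = solve-∀
∑-linear (suc n) a b f g =
  trans (cong (a *ℤ f zero +ℤ b *ℤ g zero +ℤ_) (∑-linear n a b (f ∘ suc) (g ∘ suc)))
        (lemma a b (f zero) (g zero) _ _)
  where
  lemma : ∀ a b x y s t → a *ℤ x +ℤ b *ℤ y +ℤ (a *ℤ s +ℤ b *ℤ t) ≡ a *ℤ (x +ℤ s) +ℤ b *ℤ (y +ℤ t)
  lemma = solve-∀

∑-scale : ∀ n a (f : Fin n → ℤ) → ∑ n (λ i → a *ℤ f i) ≡ a *ℤ ∑ n f
∑-scale zero    a f = sym (ℤₚ.*-zeroʳ a)
∑-scale (suc n) a f =
  trans (cong (a *ℤ f zero +ℤ_) (∑-scale n a (f ∘ suc))) (sym (ℤₚ.*-distribˡ-+ a (f zero) _))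

∑-neg : ∀ n (f : Fin n → ℤ) → ∑ n (λ i → - f i) ≡ - ∑ n f
∑-neg zero    f = refl
∑-neg (suc n) f =
  trans (cong (- f zero +ℤ_) (∑-neg n (f ∘ suc))) (sym (ℤₚ.neg-distrib-+ (f zero) _))

det-cong : ∀ n {M N : Fin n → Fin n → ℤ} → (∀ i j → M i j ≡ N i j) → det n M ≡ det n N
det-cong zero    M≗N = refl
det-cong (suc n) M≗N = ∑-cong (suc n) λ j →
  cong₂ (λ x y → sgn (toℕ j) *ℤ x *ℤ y) (M≗N zero j) (det-cong n λ r c → M≗N (suc r) (punchIn j c))

det-scale : ∀ n a (M : Fin n → Fin n → ℤ) → det n (λ i j → a *ℤ M i j) ≡ a ℤ.^ n *ℤ det n M
det-scale zero    a M = refl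
det-scale (suc n) a M = trans (∑-cong (suc n) step) (∑-scale (suc n) (a ℤ.^ suc n) term)
  where
  term : Fin (suc n) → ℤ
  term j = sgn (toℕ j) *ℤ M zero j *ℤ det n (λ r c → M (suc r) (punchIn j c))
  lemma : ∀ a s m p d → s *ℤ (a *ℤ m) *ℤ (p *ℤ d) ≡ (a *ℤ p) *ℤ (s *ℤ m *ℤ d)
  lemma = solve-∀
  step : ∀ j → _
  step j = trans (cong (sgn (toℕ j) *ℤ (a *ℤ M zero j) *ℤ_) (det-scale n a λ r c → M (suc r) (punchIn j c)))
                 (lemma a (sgn (toℕ j)) (M zero j) (a ℤ.^ n) _)

scaleRow₀ : ∀ {n} → ℤ → (Fin (suc n) → Fin (suc n) → ℤ) → Fin (suc n) → Fin (suc n) → ℤ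
scaleRow₀ a M zero    j = a *ℤ M zero j
scaleRow₀ a M (suc i) j = M (suc i) j

det-scaleRow₀ : ∀ n a (M : Fin (suc n) → Fin (suc n) → ℤ) → det (suc n) (scaleRow₀ a M) ≡ a *ℤ det (suc n) M
det-scaleRow₀ n a M = trans (∑-cong (suc n) λ j → lemma a (sgn (toℕ j)) (M zero j) (minor j))
                              (∑-scale (suc n) a λ j → sgn (toℕ j) *ℤ M zero j *ℤ minor j)
  where
  minor : Fin (suc n) → ℤ
  minor j = det n λ r c → M (suc r) (punchIn j c)
  lemma : ∀ a s m d → s *ℤ (a *ℤ m) *ℤ d ≡ a *ℤ (s *ℤ m *ℤ d)
  lemma = solve-∀

-- Schur complements through the expansion along two rows.

-- The Laplace expansion along two rows x and y; E j k stands for the minor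
-- without column j and without column k of the remaining ones.
∑∑ : ∀ m → (x y : Fin (suc m) → ℤ) → (Fin (suc m) → Fin m → ℤ) → ℤ
∑∑ m x y E = ∑ (suc m) λ j → sgn (toℕ j) *ℤ x j *ℤ ∑ m λ k → sgn (toℕ k) *ℤ y (punchIn j k) *ℤ E j k

-- E j k only depends on the two-element set {j, punchIn j k}.
Unordered : ∀ m → (Fin (suc m) → Fin m → ℤ) → Set
Unordered zero    E = ⊤
Unordered (suc m) E = (∀ k → E zero k ≡ E (suc k) zero) × Unordered m (λ j k → E (suc j) (suc k))

withColumn₀ : ∀ {m} → (Fin (suc (suc m)) → Fin (suc m) → ℤ) → (Fin (suc (suc m)) → ℤ) → ℤ
withColumn₀ {m} E z = ∑ (suc m) λ k → sgn (toℕ k) *ℤ z (suc k) *ℤ E zero k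

-- The terms are sorted by which row takes column 0: row x, row y, or neither. If y takes it, x sits
-- one column further right, which produces the minus sign; if neither does, both signs flip and
-- cancel.
∑∑-split : ∀ m (x y : Fin (suc (suc m)) → ℤ) E → (∀ k → E zero k ≡ E (suc k) zero) →
  ∑∑ (suc m) x y E ≡
    x zero *ℤ withColumn₀ E y -ℤ y zero *ℤ withColumn₀ E x +ℤ ∑∑ m (x ∘ suc) (y ∘ suc) (λ j k → E (suc j) (suc k))
∑∑-split m x y E E-sym =
  trans (cong (1ℤ *ℤ x zero *ℤ A y +ℤ_)
          (trans (∑-cong (suc m) term) (∑-linear (suc m) (- y zero) 1ℤ
            (λ j → sgn (toℕ j) *ℤ x (suc j) *ℤ E zero j)
            (λ j → sgn (toℕ j) *ℤ x (suc j) *ℤ ∑ m (inner j)))))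
        (lemma (x zero) (y zero) (A x) (A y) (∑∑ m (x ∘ suc) (y ∘ suc) λ j k → E (suc j) (suc k)))
  where
  A : (Fin (suc (suc m)) → ℤ) → ℤ
  A = withColumn₀ E
  lemma : ∀ x y a b w → 1ℤ *ℤ x *ℤ b +ℤ (- y *ℤ a +ℤ 1ℤ *ℤ w) ≡ x *ℤ b -ℤ y *ℤ a +ℤ w
  lemma = solve-∀
  inner : Fin (suc m) → Fin m → ℤ
  inner j k = sgn (toℕ k) *ℤ y (suc (punchIn j k)) *ℤ E (suc j) (suc k)
  neg-inner : ∀ s y e → - s *ℤ y *ℤ e ≡ - (s *ℤ y *ℤ e)
  neg-inner = solve-∀
  regroup : ∀ s x y e w → - s *ℤ x *ℤ (1ℤ *ℤ y *ℤ e +ℤ - w) ≡ - y *ℤ (s *ℤ x *ℤ e) +ℤ 1ℤ *ℤ (s *ℤ x *ℤ w)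
  regroup = solve-∀
  term : ∀ j → - sgn (toℕ j) *ℤ x (suc j) *ℤ
                 (1ℤ *ℤ y zero *ℤ E (suc j) zero
                   +ℤ ∑ m (λ k → - sgn (toℕ k) *ℤ y (suc (punchIn j k)) *ℤ E (suc j) (suc k)))
             ≡ - y zero *ℤ (sgn (toℕ j) *ℤ x (suc j) *ℤ E zero j)
                 +ℤ 1ℤ *ℤ (sgn (toℕ j) *ℤ x (suc j) *ℤ ∑ m (inner j))
  term j = trans
    (cong₂ (λ e w → - sgn (toℕ j) *ℤ x (suc j) *ℤ (1ℤ *ℤ y zero *ℤ e +ℤ w))
           (sym (E-sym j))
           (trans (∑-cong m λ k → neg-inner (sgn (toℕ k)) _ _) (∑-neg m (inner j))))
    (regroup (sgn (toℕ j)) (x (suc j)) (y zero) (E zero j) (∑ m (inner j)))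

-- Column 0 is split off repeatedly: its contribution x₀ A(y) - y₀ A(x) is visibly antisymmetric,
-- and the rest is an expansion of the same kind with one column fewer.
∑∑-antisym : ∀ m x y E → Unordered m E → ∑∑ m x y E ≡ - ∑∑ m y x E
∑∑-antisym zero    x y E _ = lemma (x zero) (y zero)
  where
  lemma : ∀ x y → 1ℤ *ℤ x *ℤ + 0 +ℤ + 0 ≡ - (1ℤ *ℤ y *ℤ + 0 +ℤ + 0)
  lemma = solve-∀
∑∑-antisym (suc m) x y E (E-sym , rest) =
  trans (∑∑-split m x y E E-sym)
  (trans (cong (x zero *ℤ A y -ℤ y zero *ℤ A x +ℤ_) (∑∑-antisym m (x ∘ suc) (y ∘ suc) _ rest))
  (trans (lemma (x zero) (y zero) (A x) (A y) (∑∑ m (y ∘ suc) (x ∘ suc) λ j k → E (suc j) (suc k)))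
         (cong -_ (sym (∑∑-split m y x E E-sym)))))
  where
  A : (Fin (suc (suc m)) → ℤ) → ℤ
  A = withColumn₀ E
  lemma : ∀ x y a b w → x *ℤ b -ℤ y *ℤ a +ℤ - w ≡ - (y *ℤ a -ℤ x *ℤ b +ℤ w)
  lemma = solve-∀

∑∑-alternating : ∀ m x E → Unordered m E → ∑∑ m x x E ≡ 0ℤ
∑∑-alternating m x E E-unordered = i≡-i⇒i≡0 (∑∑-antisym m x x E E-unordered)
  where
  i≡-i⇒i≡0 : ∀ {i} → i ≡ - i → i ≡ 0ℤ
  i≡-i⇒i≡0 {+ zero} _ = refl

∑∑-linearˡ : ∀ m (x y z : Fin (suc m) → ℤ) a E →
  ∑∑ m (λ j → x j -ℤ a *ℤ y j) z E ≡ ∑∑ m x z E -ℤ a *ℤ ∑∑ m y z E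
∑∑-linearˡ m x y z a E =
  trans (∑-cong (suc m) λ j → lemma (sgn (toℕ j)) (x j) (y j) a (cofactor j))
  (trans (∑-linear (suc m) 1ℤ (- a) (λ j → sgn (toℕ j) *ℤ x j *ℤ cofactor j)
                                    (λ j → sgn (toℕ j) *ℤ y j *ℤ cofactor j))
         (unit (∑∑ m x z E) a (∑∑ m y z E)))
  where
  cofactor : Fin (suc m) → ℤ
  cofactor j = ∑ m λ k → sgn (toℕ k) *ℤ z (punchIn j k) *ℤ E j k
  lemma : ∀ s x y a w → s *ℤ (x -ℤ a *ℤ y) *ℤ w ≡ 1ℤ *ℤ (s *ℤ x *ℤ w) +ℤ - a *ℤ (s *ℤ y *ℤ w)
  lemma = solve-∀
  unit : ∀ p a q → 1ℤ *ℤ p +ℤ - a *ℤ q ≡ p -ℤ a *ℤ q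
  unit = solve-∀

-- `φ` stands for the determinant of the remaining rows as a function of the chosen columns. Keeping
-- it abstract lets the induction pass to `φ ∘ extend`, the selections that retain column 0; the
-- congruence hypothesis replaces function extensionality.
removeTwo-unordered : ∀ n (φ : (Fin n → Fin (suc (suc n))) → ℤ) →
  (∀ {σ τ} → (∀ c → σ c ≡ τ c) → φ σ ≡ φ τ) →
  Unordered (suc n) (λ j k → φ (λ c → punchIn j (punchIn k c)))
removeTwo-unordered zero    φ φ-cong = (λ k → φ-cong λ ()) , tt
removeTwo-unordered (suc n) φ φ-cong =
  (λ k → φ-cong λ c → refl) ,
  subst-unordered (suc n)
    (λ j k → φ-cong {extend λ c → punchIn j (punchIn k c)} {λ c → punchIn (suc j) (punchIn (suc k) c)}
               λ { zero → refl ; (suc c) → refl })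
    (removeTwo-unordered n (φ ∘ extend) λ σ≗τ → φ-cong λ { zero → refl ; (suc c) → cong suc (σ≗τ c) })
  where
  extend : (Fin n → Fin (suc (suc n))) → Fin (suc n) → Fin (suc (suc (suc n)))
  extend σ zero    = zero
  extend σ (suc c) = suc (σ c)
  subst-unordered : ∀ m {E F : Fin (suc m) → Fin m → ℤ} → (∀ j k → E j k ≡ F j k) → Unordered m E → Unordered m F
  subst-unordered zero    E≗F _ = tt
  subst-unordered (suc m) E≗F (p , q) =
    (λ k → trans (sym (E≗F zero k)) (trans (p k) (E≗F (suc k) zero))) ,
    subst-unordered m (λ j k → E≗F (suc j) (suc k)) q

-- The pivot is taken to be 1, so that no division occurs.
schur : ∀ {n} → (Fin (suc n) → Fin (suc n) → ℤ) → Fin n → Fin n → ℤ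
schur M i j = M (suc i) (suc j) -ℤ M (suc i) zero *ℤ M zero (suc j)

-- Both sides are expanded along row 1 of M. Subtracting M 1 0 times row 0 from
-- row 1 changes nothing, since the expansion is alternating in the two rows.
det-schur : ∀ n (M : Fin (suc n) → Fin (suc n) → ℤ) → M zero zero ≡ 1ℤ → det (suc n) M ≡ det n (schur M)
det-schur zero    M M₀₀≡1 = cong (λ m → 1ℤ *ℤ m *ℤ 1ℤ +ℤ + 0) M₀₀≡1
det-schur (suc n) M M₀₀≡1 = begin
  ∑∑ (suc n) x y E                                       ≡⟨ ∑∑-antisym (suc n) x y E E-unordered ⟩
  - ∑∑ (suc n) y x E                                     ≡⟨ cong -_ (drop (∑∑ (suc n) y x E) (y zero)) ⟩
  - (∑∑ (suc n) y x E -ℤ y zero *ℤ 0ℤ)                   ≡⟨ cong (λ w → - (∑∑ (suc n) y x E -ℤ y zero *ℤ w))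
                                                              (∑∑-alternating (suc n) x E E-unordered) ⟨
  - (∑∑ (suc n) y x E -ℤ y zero *ℤ ∑∑ (suc n) x x E)     ≡⟨ cong -_ (∑∑-linearˡ (suc n) y x x (y zero) E) ⟨
  -- With `y′` outermost this is the Laplace expansion along the modified row 1. Its column 0 term
  -- vanishes because y′₀ = y₀ - y₀ · 1.
  - ∑∑ (suc n) y′ x E                                    ≡⟨ cong -_ (cong₂ _+ℤ_ y′₀-term (∑-cong (suc n) λ j →
                                                              neg-term (sgn (toℕ j)) (y′ (suc j)) (det (suc n) (minor (suc j))))) ⟩
  - (0ℤ +ℤ ∑ (suc n) (λ j → - expansion j))              ≡⟨ cong (λ w → - (0ℤ +ℤ w)) (∑-neg (suc n) expansion) ⟩
  - (0ℤ +ℤ - ∑ (suc n) expansion)                        ≡⟨ double-neg _ ⟩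
  -- `minor (suc j)` keeps row 0 and column 0, hence the pivot 1. Its Schur complement is the minor
  -- of `schur M` that belongs to column j of the first row.
  ∑ (suc n) expansion                                    ≡⟨ ∑-cong (suc n) (λ j → cong (sgn (toℕ j) *ℤ y′ (suc j) *ℤ_)
                                                              (det-schur n (minor (suc j)) M₀₀≡1)) ⟩
  det (suc n) (schur M)                                  ∎
  where
  open ≡-Reasoning
  x y y′ : Fin (suc (suc n)) → ℤ
  x = M zero
  y = M (suc zero)
  y′ j = y j -ℤ y zero *ℤ x j
  φ : (Fin n → Fin (suc (suc n))) → ℤ
  φ σ = det n λ r c → M (suc (suc r)) (σ c)
  E : Fin (suc (suc n)) → Fin (suc n) → ℤ
  E j k = φ λ c → punchIn j (punchIn k c)
  E-unordered : Unordered (suc n) E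
  E-unordered = removeTwo-unordered n φ λ σ≗τ → det-cong n λ r c → cong (M (suc (suc r))) (σ≗τ c)
  minor : Fin (suc (suc n)) → Fin (suc n) → Fin (suc n) → ℤ
  minor j r c = M (punchIn (suc zero) r) (punchIn j c)
  expansion : Fin (suc n) → ℤ
  expansion j = sgn (toℕ j) *ℤ y′ (suc j) *ℤ det (suc n) (minor (suc j))
  drop : ∀ w a → w ≡ w -ℤ a *ℤ 0ℤ
  drop = solve-∀
  neg-term : ∀ s a w → - s *ℤ a *ℤ w ≡ - (s *ℤ a *ℤ w)
  neg-term = solve-∀
  double-neg : ∀ w → - (0ℤ +ℤ - w) ≡ w
  double-neg = solve-∀
  vanish : ∀ a w → 1ℤ *ℤ (a -ℤ a *ℤ 1ℤ) *ℤ w ≡ 0ℤ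
  vanish = solve-∀
  y′₀-term : 1ℤ *ℤ y′ zero *ℤ det (suc n) (minor zero) ≡ 0ℤ
  y′₀-term = trans (cong (λ m → 1ℤ *ℤ (y zero -ℤ y zero *ℤ m) *ℤ det (suc n) (minor zero)) M₀₀≡1)
                   (vanish (y zero) (det (suc n) (minor zero)))

-- Reduction modulo 2

par : ℤ → Parity
par z = parity ∣ z ∣

parity-suc : ∀ n → parity (suc n) ≡ 1ℙ ⊕ parity n
parity-suc n = trans (sym (ℙₚ.⁻¹-involutive (parity (suc n)))) (cong _⁻¹ (ℙₚ.suc-homo-⁻¹ n))

par-⊖ : ∀ m n → par (m ⊖ n) ≡ parity m ⊕ parity n
par-⊖ zero    zero    = refl
par-⊖ zero    (suc n) = refl
par-⊖ (suc m) zero    = sym (ℙₚ.+-identityʳ _)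
par-⊖ (suc m) (suc n) rewrite ℤₚ.[1+m]⊖[1+n]≡m⊖n m n | parity-suc m | parity-suc n =
  trans (par-⊖ m n) (lemma (parity m) (parity n))
  where
  open ℙ-Solver
  lemma : ∀ p q → p ⊕ q ≡ (1ℙ ⊕ p) ⊕ (1ℙ ⊕ q)
  lemma = solve 2 (λ p q → p :+ q := (con 1ℙ :+ p) :+ (con 1ℙ :+ q)) refl

par-+ : ∀ i j → par (i +ℤ j) ≡ par i ⊕ par j
par-+ (+ m)    (+ n)    = ℙₚ.+-homo-+ m n
par-+ (+ m)    -[1+ n ] = par-⊖ m (suc n)
par-+ -[1+ m ] (+ n)    = trans (par-⊖ n (suc m)) (ℙₚ.+-comm (parity n) (parity (suc m)))
par-+ -[1+ m ] -[1+ n ] =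
  trans (cong (parity ∘ suc) (sym (ℕₚ.+-suc m n))) (ℙₚ.+-homo-+ (suc m) (suc n))

par-* : ∀ i j → par (i *ℤ j) ≡ par i ⊗ par j
par-* i j = trans (cong parity (ℤₚ.abs-* i j)) (ℙₚ.*-homo-* ∣ i ∣ ∣ j ∣)

par-neg : ∀ i → par (- i) ≡ par i
par-neg i = cong parity (ℤₚ.∣-i∣≡∣i∣ i)

par-- : ∀ i j → par (i -ℤ j) ≡ par i ⊕ par j
par-- i j = trans (par-+ i (- j)) (cong (par i ⊕_) (par-neg j))

par-∑-cong : ∀ n (f g : Fin n → ℤ) → (∀ i → par (f i) ≡ par (g i)) → par (∑ n f) ≡ par (∑ n g)
par-∑-cong zero    f g f≗g = refl
par-∑-cong (suc n) f g f≗g =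
  trans (par-+ (f zero) (∑ n (f ∘ suc)))
  (trans (cong₂ _⊕_ (f≗g zero) (par-∑-cong n (f ∘ suc) (g ∘ suc) (f≗g ∘ suc)))
         (sym (par-+ (g zero) (∑ n (g ∘ suc)))))

par-det-cong : ∀ n (M N : Fin n → Fin n → ℤ) →
               (∀ i j → par (M i j) ≡ par (N i j)) → par (det n M) ≡ par (det n N)
par-det-cong zero    M N M≗N = refl
par-det-cong (suc n) M N M≗N = par-∑-cong (suc n) (term M) (term N) λ j →
  trans (par-*³ (sgn (toℕ j)) (M zero j) (det n (minor M j)))
  (trans (cong₂ (λ x y → par (sgn (toℕ j)) ⊗ x ⊗ y) (M≗N zero j)
                (par-det-cong n (minor M j) (minor N j) λ r c → M≗N (suc r) (punchIn j c)))
         (sym (par-*³ (sgn (toℕ j)) (N zero j) (det n (minor N j)))))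
  where
  minor : (Fin (suc n) → Fin (suc n) → ℤ) → Fin (suc n) → Fin n → Fin n → ℤ
  minor L j r c = L (suc r) (punchIn j c)
  term : (Fin (suc n) → Fin (suc n) → ℤ) → Fin (suc n) → ℤ
  term L j = sgn (toℕ j) *ℤ L zero j *ℤ det n (minor L j)
  par-*³ : ∀ a b c → par (a *ℤ b *ℤ c) ≡ par a ⊗ par b ⊗ par c
  par-*³ a b c = trans (par-* (a *ℤ b) c) (cong (_⊗ par c) (par-* a b))

lift : Parity → ℤ
lift 0ℙ = 0ℤ
lift 1ℙ = 1ℤ

par-lift : ∀ p → par (lift p) ≡ p
par-lift 0ℙ = refl
par-lift 1ℙ = refl

decompose : ∀ z → ∃ λ k → z ≡ + 2 *ℤ k +ℤ lift (par z)
decompose (+ n)    = decomposeℕ n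
  where
  next : ∀ k p → + 2 +ℤ (+ 2 *ℤ k +ℤ p) ≡ + 2 *ℤ (k +ℤ 1ℤ) +ℤ p
  next = solve-∀
  decomposeℕ : ∀ n → ∃ λ k → + n ≡ + 2 *ℤ k +ℤ lift (parity n)
  decomposeℕ zero          = 0ℤ , refl
  decomposeℕ (suc zero)    = 0ℤ , refl
  decomposeℕ (suc (suc n)) with decomposeℕ n
  ... | k , n≡2k+p = k +ℤ 1ℤ , trans (cong (+ 2 +ℤ_) n≡2k+p) (next k (lift (parity n)))
decompose -[1+ n ] with decompose (+ suc n)
... | k , n≡2k+p = - k -ℤ lift p , trans (cong -_ n≡2k+p) (negate k (lift p))
  where
  p = parity (suc n)
  negate : ∀ k p → - (+ 2 *ℤ k +ℤ p) ≡ + 2 *ℤ (- k -ℤ p) +ℤ p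
  negate = solve-∀

-- Cancelling 2^m turns both sides of the theorem into statements about parities.
oddMultiple⇔ : ∀ m z → OddMultipleOf2^ m (+ (2 ^ m) *ℤ z) ⇔ par z ≡ 1ℙ
oddMultiple⇔ m z = mk⇔ to from
  where
  instance
    2^m≢0 = ℕₚ.m^n≢0 2 m
  to : OddMultipleOf2^ m (+ (2 ^ m) *ℤ z) → par z ≡ 1ℙ
  to (k , eq) rewrite ℤₚ.*-cancelˡ-≡ (+ (2 ^ m)) z (+ 2 *ℤ k +ℤ 1ℤ) eq =
    trans (par-+ (+ 2 *ℤ k) 1ℤ) (cong (_⊕ 1ℙ) (par-* (+ 2) k))
  from : par z ≡ 1ℙ → OddMultipleOf2^ m (+ (2 ^ m) *ℤ z)
  from z-odd with decompose z
  ... | k , z≡2k+p = k , cong (+ (2 ^ m) *ℤ_) (trans z≡2k+p (cong (λ p → + 2 *ℤ k +ℤ lift p) z-odd))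

-- Power series over 𝔽₂

Series : Set
Series = ℕ → Parity

conv : Series → Series → Series
conv u v zero    = u 0 ⊗ v 0
conv u v (suc k) = u 0 ⊗ v (suc k) ⊕ conv (u ∘ suc) v k

conv-sucʳ : ∀ u v k → conv u v (suc k) ≡ conv u (v ∘ suc) k ⊕ u (suc k) ⊗ v 0
conv-sucʳ u v zero    = refl
conv-sucʳ u v (suc k) =
  trans (cong (u 0 ⊗ v (suc (suc k)) ⊕_) (conv-sucʳ (u ∘ suc) v k))
        (sym (ℙₚ.+-assoc (u 0 ⊗ v (suc (suc k))) _ _))

conv-comm : ∀ u v k → conv u v k ≡ conv v u k
conv-comm u v zero    = ℙₚ.*-comm (u 0) (v 0)
conv-comm u v (suc k) =
  trans (cong₂ _⊕_ (ℙₚ.*-comm (u 0) (v (suc k))) (conv-comm (u ∘ suc) v k))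
  (trans (ℙₚ.+-comm (v (suc k) ⊗ u 0) _) (sym (conv-sucʳ v u k)))

-- The combination u + v + a w has the shape of `remainder`.
conv-linearˡ : ∀ u v w a z k → conv (λ i → u i ⊕ v i ⊕ a ⊗ w i) z k ≡ conv u z k ⊕ conv v z k ⊕ a ⊗ conv w z k
conv-linearˡ u v w a z zero = lemma (u 0) (v 0) (w 0) a (z 0)
  where
  open ℙ-Solver
  lemma : ∀ u v w a z → (u ⊕ v ⊕ a ⊗ w) ⊗ z ≡ u ⊗ z ⊕ v ⊗ z ⊕ a ⊗ (w ⊗ z)
  lemma = solve 5 (λ u v w a z → (u :+ v :+ a :* w) :* z := u :* z :+ v :* z :+ a :* (w :* z)) refl
conv-linearˡ u v w a z (suc k) =
  trans (cong ((u 0 ⊕ v 0 ⊕ a ⊗ w 0) ⊗ z (suc k) ⊕_) (conv-linearˡ (u ∘ suc) (v ∘ suc) (w ∘ suc) a z k))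
        (lemma (u 0) (v 0) (w 0) a (z (suc k)) _ _ _)
  where
  open ℙ-Solver
  lemma : ∀ u v w a z p q r →
    (u ⊕ v ⊕ a ⊗ w) ⊗ z ⊕ (p ⊕ q ⊕ a ⊗ r) ≡ (u ⊗ z ⊕ p) ⊕ (v ⊗ z ⊕ q) ⊕ a ⊗ (w ⊗ z ⊕ r)
  lemma = solve 8 (λ u v w a z p q r →
    (u :+ v :+ a :* w) :* z :+ (p :+ q :+ a :* r) := (u :* z :+ p) :+ (v :* z :+ q) :+ a :* (w :* z :+ r)) refl

-- Unlike `2 * n`, this exposes two successors at once, so `conv` unfolds at such indices by
-- computation.
double : ℕ → ℕ
double zero    = zero
double (suc n) = suc (suc (double n))

double≡2* : ∀ n → double n ≡ 2 * n
double≡2* zero    = refl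
double≡2* (suc n) = cong suc (trans (cong suc (double≡2* n)) (sym (ℕₚ.+-suc n (n + 0))))

-- The two outer terms, both v₀ v_{k+2}, cancel in characteristic 2.
square-shift : ∀ v k → conv v v (suc (suc k)) ≡ conv (v ∘ suc) (v ∘ suc) k
square-shift v k =
  trans (cong (v 0 ⊗ v (suc (suc k)) ⊕_) (conv-sucʳ (v ∘ suc) v k)) (lemma (v 0) (v (suc (suc k))) _)
  where
  open ℙ-Solver
  lemma : ∀ p q r → p ⊗ q ⊕ (r ⊕ q ⊗ p) ≡ r
  lemma = solve 3 (λ p q r → p :* q :+ (r :+ q :* p) := r) refl

-- Together with `square-odd` this is the Frobenius identity v(t)² = v(t²) over 𝔽₂.
square-even : ∀ v n → conv v v (double n) ≡ v n
square-even v zero    = ℙₚ.*-idem (v 0)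
square-even v (suc n) = trans (square-shift v (double n)) (square-even (v ∘ suc) n)

square-odd : ∀ v n → conv v v (suc (double n)) ≡ 0ℙ
square-odd v zero    = trans (cong (v 0 ⊗ v 1 ⊕_) (ℙₚ.*-comm (v 1) (v 0))) (ℙₚ.p+p≡0ℙ (v 0 ⊗ v 1))
square-odd v (suc n) = trans (square-shift v (suc (double n))) (square-odd (v ∘ suc) n)

-- The remainder of a division step u = (1 + a t) v + t² (remainder u v) of
-- series with constant term 1, where a = u₁ + v₁.
remainder : Series → Series → Series
remainder u v k = u (suc (suc k)) ⊕ v (suc (suc k)) ⊕ (u 1 ⊕ v 1) ⊗ v (suc k)

-- The coefficient of t^(k+2) in u v = (1 + a t) v² + t² v w, where w is the remainder.
conv-remainder : ∀ u v → u 0 ≡ 1ℙ → v 0 ≡ 1ℙ → ∀ k →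
  conv u v (suc (suc k)) ≡
    conv v (remainder u v) k ⊕ conv v v (suc (suc k)) ⊕ (u 1 ⊕ v 1) ⊗ conv v v (suc k)
conv-remainder u v u₀≡1 v₀≡1 k
  rewrite trans (conv-comm v (remainder u v) k)
                (conv-linearˡ (λ i → u (suc (suc i))) (λ i → v (suc (suc i))) (v ∘ suc) (u 1 ⊕ v 1) v k)
        | u₀≡1 | v₀≡1 = lemma (u 1) (v 1) (v (suc k)) (v (suc (suc k))) _ _ _
  where
  open ℙ-Solver
  lemma : ∀ u₁ v₁ p q x y z →
    q ⊕ (u₁ ⊗ p ⊕ x) ≡ (x ⊕ y ⊕ (u₁ ⊕ v₁) ⊗ z) ⊕ (q ⊕ (v₁ ⊗ p ⊕ y)) ⊕ (u₁ ⊕ v₁) ⊗ (p ⊕ z)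
  lemma = solve 7 (λ u₁ v₁ p q x y z →
    q :+ (u₁ :* p :+ x) :=
      (x :+ y :+ (u₁ :+ v₁) :* z) :+ (q :+ (v₁ :* p :+ y)) :+ (u₁ :+ v₁) :* (p :+ z)) refl

-- The even-index coefficients of u² + (1 + t) u v + t² v².
defect : Series → Series → Series
defect u v zero    = u 0 ⊗ v 0 ⊕ u 0
defect u v (suc n) = v n ⊕ (conv u v (double (suc n)) ⊕ conv u v (suc (double n))) ⊕ u (suc n)

-- In Q(u, v) = (1 + a) t v² + t² Q(v, w) the first summand has only odd exponents, since v² has
-- only even ones. The factor t² moves the even-index coefficients by one place.
defect-suc : ∀ u v → u 0 ≡ 1ℙ → v 0 ≡ 1ℙ → ∀ n → defect u v (suc n) ≡ defect v (remainder u v) n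
defect-suc u v u₀≡1 v₀≡1 zero
  rewrite conv-remainder u v u₀≡1 v₀≡1 0 | square-even v 1 | square-odd v 0 | u₀≡1 | v₀≡1
        = lemma (u 1) (v 1) (remainder u v 0)
  where
  open ℙ-Solver
  lemma : ∀ p q r → 1ℙ ⊕ (r ⊕ q ⊕ (p ⊕ q) ⊗ 0ℙ ⊕ (q ⊕ p ⊗ 1ℙ)) ⊕ p ≡ r ⊕ 1ℙ
  lemma = solve 3 (λ p q r →
    con 1ℙ :+ (r :+ q :+ (p :+ q) :* con 0ℙ :+ (q :+ p :* con 1ℙ)) :+ p := r :+ con 1ℙ) refl
defect-suc u v u₀≡1 v₀≡1 (suc n)
  rewrite conv-remainder u v u₀≡1 v₀≡1 (double (suc n))
        | conv-remainder u v u₀≡1 v₀≡1 (suc (double n))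
        | square-odd v (suc n) | square-even v (suc (suc n)) | square-even v (suc n)
        = lemma (u 1 ⊕ v 1) (v (suc n)) (v (suc (suc n))) (u (suc (suc n)))
            (conv v (remainder u v) (double (suc n))) (conv v (remainder u v) (suc (double n)))
  where
  open ℙ-Solver
  lemma : ∀ a p q r x y →
    p ⊕ (x ⊕ q ⊕ a ⊗ 0ℙ ⊕ (y ⊕ 0ℙ ⊕ a ⊗ p)) ⊕ r ≡ (r ⊕ q ⊕ a ⊗ p) ⊕ (x ⊕ y) ⊕ p
  lemma = solve 6 (λ a p q r x y →
    p :+ (x :+ q :+ a :* con 0ℙ :+ (y :+ con 0ℙ :+ a :* p)) :+ r :=
      (r :+ q :+ a :* p) :+ (x :+ y) :+ p) refl

-- Bézoutians over 𝔽₂ and the Euclidean algorithm.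

-- If u₀ = 1, these are the coefficients of (s v(s) u(t) + t u(s) v(t)) / (s + t).
record IsBezoutian (u v : Series) (B : ℕ → ℕ → Parity) : Set where
  field
    row₀ : ∀ j → B 0 j ≡ v j
    col₀ : ∀ i → B i 0 ≡ v i
    step : ∀ i j → B (suc i) j ≡ B i (suc j) ⊕ (v i ⊗ u (suc j) ⊕ u (suc i) ⊗ v j)

schurℙ : (ℕ → ℕ → Parity) → ℕ → ℕ → Parity
schurℙ B i j = B (suc i) (suc j) ⊕ B (suc i) 0 ⊗ B 0 (suc j)

-- In the `step` law the product subtracted by the Schur complement contributes v_{i+2} v_{j+1} +
-- v_{i+1} v_{j+2}, which completes u_{i+2} and u_{j+2} to coefficients of the remainder. The
-- missing term (u₁ + v₁) v_{i+1} v_{j+1} occurs twice and cancels.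
schur-isBezoutian : ∀ {u v B} → v 0 ≡ 1ℙ → IsBezoutian u v B → IsBezoutian v (remainder u v) (schurℙ B)
schur-isBezoutian {u} {v} {B} v₀≡1 bez = record { row₀ = row₀′ ; col₀ = col₀′ ; step = step′ }
  where
  open IsBezoutian bez
  open ℙ-Solver
  row₀′ : ∀ j → schurℙ B 0 j ≡ remainder u v j
  row₀′ j rewrite step 0 (suc j) | row₀ (suc (suc j)) | row₀ (suc j) | col₀ 1 | v₀≡1 =
    solve 5 (λ a b p q r → q :+ (r :+ a :* p) :+ b :* p := r :+ q :+ (a :+ b) :* p) refl
      (u 1) (v 1) (v (suc j)) (v (suc (suc j))) (u (suc (suc j)))
  col₀′ : ∀ i → schurℙ B i 0 ≡ remainder u v i
  -- The coefficient v_{i+2} is read backwards as the entry B (i+2) 0, so that `step` expresses it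
  -- through B (i+1) 1, which the left side contains.
  col₀′ i rewrite sym (col₀ (suc (suc i))) | step (suc i) 0 | row₀ 1 | col₀ (suc i) | v₀≡1 =
    solve 5 (λ a b p r x → x :+ p :* b := r :+ (x :+ (p :* a :+ r :* con 1ℙ)) :+ (a :+ b) :* p) refl
      (u 1) (v 1) (v (suc i)) (u (suc (suc i))) (B (suc i) 1)
  step′ : ∀ i j → schurℙ B (suc i) j ≡
    schurℙ B i (suc j) ⊕ (remainder u v i ⊗ v (suc j) ⊕ v (suc i) ⊗ remainder u v j)
  step′ i j rewrite step (suc i) (suc j) | row₀ (suc j) | row₀ (suc (suc j))
                  | col₀ (suc i) | col₀ (suc (suc i)) =
    solve 8 (λ a p q r p′ q′ r′ x →
        x :+ (p :* r′ :+ r :* p′) :+ q :* p′ :=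
        x :+ p :* q′ :+ ((r :+ q :+ a :* p) :* p′ :+ p :* (r′ :+ q′ :+ a :* p′))) refl
      (u 1 ⊕ v 1) (v (suc i)) (v (suc (suc i))) (u (suc (suc i)))
      (v (suc j)) (v (suc (suc j))) (u (suc (suc j))) (B (suc i) (suc (suc j)))

-- Induction on n with one Schur complement per Euclidean step: the vanishing of `defect u v 0`
-- provides the pivot v₀ = 1, and `defect-suc` passes the other zeros on to the pair (v, w).
det-bezoutian : ∀ n {M : Fin (suc n) → Fin (suc n) → ℤ} {u v B} →
  (∀ i j → par (M i j) ≡ B (toℕ i) (toℕ j)) → IsBezoutian u v B → u 0 ≡ 1ℙ →
  (∀ i → i < n → defect u v i ≡ 0ℙ) → par (det (suc n) M) ≡ 1ℙ ⊕ defect u v n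
det-bezoutian zero {M} {u} {v} {B} M≗B bez u₀≡1 _ = begin
  par (1ℤ *ℤ M zero zero *ℤ 1ℤ +ℤ + 0) ≡⟨ cong par (unit (M zero zero)) ⟩
  par (M zero zero)                    ≡⟨ M≗B zero zero ⟩
  B 0 0                                ≡⟨ IsBezoutian.row₀ bez 0 ⟩
  v 0                                  ≡⟨ solve 1 (λ x → x := con 1ℙ :+ (con 1ℙ :* x :+ con 1ℙ)) refl (v 0) ⟩
  1ℙ ⊕ (1ℙ ⊗ v 0 ⊕ 1ℙ)                 ≡⟨ cong (λ x → 1ℙ ⊕ (x ⊗ v 0 ⊕ x)) u₀≡1 ⟨
  1ℙ ⊕ defect u v 0                    ∎
  where
  open ≡-Reasoning
  open ℙ-Solver
  unit : ∀ m → 1ℤ *ℤ m *ℤ 1ℤ +ℤ + 0 ≡ m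
  unit = solve-∀
det-bezoutian (suc n) {M} {u} {v} {B} M≗B bez u₀≡1 zeros = begin
  -- `M` is replaced by its 0/1 representative `N`, because `det-schur` needs a pivot equal to 1 and
  -- not merely odd.
  par (det (suc (suc n)) M)       ≡⟨ par-det-cong (suc (suc n)) M N (λ i j →
                                       trans (M≗B i j) (sym (par-lift (B (toℕ i) (toℕ j))))) ⟩
  par (det (suc (suc n)) N)       ≡⟨ cong par (det-schur (suc n) N (cong lift (trans (row₀ 0) v₀≡1))) ⟩
  par (det (suc n) (schur N))     ≡⟨ det-bezoutian n {schur N} schurN≗schurB (schur-isBezoutian v₀≡1 bez) v₀≡1 (λ i i<n →
                                       trans (sym (defect-suc u v u₀≡1 v₀≡1 i)) (zeros (suc i) (s<s i<n))) ⟩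
  1ℙ ⊕ defect v (remainder u v) n ≡⟨ cong (1ℙ ⊕_) (defect-suc u v u₀≡1 v₀≡1 n) ⟨
  1ℙ ⊕ defect u v (suc n)         ∎
  where
  open ≡-Reasoning
  open IsBezoutian bez
  N : Fin (suc (suc n)) → Fin (suc (suc n)) → ℤ
  N i j = lift (B (toℕ i) (toℕ j))
  v₀≡1 : v 0 ≡ 1ℙ
  -- With u₀ = 1 the first zero reads v₀ + 1 = 0, which excludes v₀ = 0.
  v₀≡1 with v 0 | subst (λ x → x ⊗ v 0 ⊕ x ≡ 0ℙ) u₀≡1 (zeros 0 z<s)
  ... | 1ℙ | _ = refl
  schurN≗schurB : ∀ i j → par (schur N i j) ≡ schurℙ B (toℕ i) (toℕ j)
  schurN≗schurB i j =
    trans (par-- (N (suc i) (suc j)) (N (suc i) zero *ℤ N zero (suc j)))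
          (cong₂ _⊕_ (par-lift (B (suc (toℕ i)) (suc (toℕ j))))
            (trans (par-* (N (suc i) zero) (N zero (suc j)))
                   (cong₂ _⊗_ (par-lift (B (suc (toℕ i)) 0)) (par-lift (B 0 (suc (toℕ j)))))))

-- Hankel matrices of sequences of signs

signℙ : Parity → ℤ
signℙ 0ℙ = 1ℤ
signℙ 1ℙ = -1ℤ

signℙ-square : ∀ p → signℙ p *ℤ signℙ p ≡ 1ℤ
signℙ-square 0ℙ = refl
signℙ-square 1ℙ = refl

par-signℙ : ∀ p → par (signℙ p) ≡ 1ℙ
par-signℙ 0ℙ = refl
par-signℙ 1ℙ = refl

signs : ∀ {d} → IsPM1Seq d → ∃ λ (x : Series) → ∀ n → d n ≡ signℙ (x n)
signs {d} d-pm1 = (λ n → proj₁ (code n)) , (λ n → proj₂ (code n))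
  where
  code : ∀ n → ∃ λ p → d n ≡ signℙ p
  code n with d-pm1 n
  ... | inj₁ eq = 0ℙ , eq
  ... | inj₂ eq = 1ℙ , eq

-- Half of (-1)^p - (-1)^q, because (-1)^p = 1 - 2p for p = 0, 1; hence the reversed order.
halfDiff : Parity → Parity → ℤ
halfDiff p q = lift q -ℤ lift p

par-halfDiff : ∀ p q → par (halfDiff p q) ≡ p ⊕ q
par-halfDiff p q = trans (par-- (lift q) (lift p)) (trans (cong₂ _⊕_ (par-lift q) (par-lift p)) (ℙₚ.+-comm q p))

signℙ-diff : ∀ p q → signℙ p -ℤ signℙ q ≡ + 2 *ℤ halfDiff p q
signℙ-diff 0ℙ 0ℙ = refl
signℙ-diff 0ℙ 1ℙ = refl
signℙ-diff 1ℙ 0ℙ = refl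
signℙ-diff 1ℙ 1ℙ = refl

signℙ-* : ∀ p q → signℙ p *ℤ signℙ q ≡ signℙ (p ⊕ q)
signℙ-* 0ℙ 0ℙ = refl
signℙ-* 0ℙ 1ℙ = refl
signℙ-* 1ℙ 0ℙ = refl
signℙ-* 1ℙ 1ℙ = refl

module SignSequence (x : Series) where

  -- Half of d_{i+j+2} - d_{i+1} d₀ d_{j+1}, an entry of the Schur complement of d₀ in the Hankel
  -- matrix; here 1/d₀ = d₀.
  core : ∀ {n} → Fin n → Fin n → ℤ
  core i j = halfDiff (x (suc (toℕ i + suc (toℕ j)))) (x (suc (toℕ i)) ⊕ (x 0 ⊕ x (suc (toℕ j))))

  -- Multiplying row 0 by d₀ makes the pivot d₀² = 1 and costs a factor d₀. Each of the n rows of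
  -- the Schur complement then yields a factor 2.
  hankel-core : ∀ n → hankel (signℙ ∘ x) (suc n) ≡ + (2 ^ n) *ℤ (signℙ (x 0) *ℤ det n core)
  hankel-core n = begin
    det (suc n) M                                       ≡⟨ ℤₚ.*-identityˡ (det (suc n) M) ⟨
    1ℤ *ℤ det (suc n) M                                 ≡⟨ cong (_*ℤ det (suc n) M) (signℙ-square (x 0)) ⟨
    s₀ *ℤ s₀ *ℤ det (suc n) M                           ≡⟨ ℤₚ.*-assoc s₀ s₀ (det (suc n) M) ⟩
    s₀ *ℤ (s₀ *ℤ det (suc n) M)                         ≡⟨ cong (s₀ *ℤ_) (det-scaleRow₀ n s₀ M) ⟨
    s₀ *ℤ det (suc n) (scaleRow₀ s₀ M)                  ≡⟨ cong (s₀ *ℤ_) (det-schur n (scaleRow₀ s₀ M) (signℙ-square (x 0))) ⟩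
    s₀ *ℤ det n (schur (scaleRow₀ s₀ M))                ≡⟨ cong (s₀ *ℤ_) (det-cong n entry) ⟩
    s₀ *ℤ det n (λ i j → + 2 *ℤ core i j)               ≡⟨ cong (s₀ *ℤ_) (det-scale n (+ 2) core) ⟩
    s₀ *ℤ ((+ 2) ℤ.^ n *ℤ det n core)                   ≡⟨ cong (λ p → s₀ *ℤ (p *ℤ det n core)) (pos-^ n) ⟨
    s₀ *ℤ (+ (2 ^ n) *ℤ det n core)                     ≡⟨ swap s₀ (+ (2 ^ n)) (det n core) ⟩
    + (2 ^ n) *ℤ (s₀ *ℤ det n core)                     ∎
    where
    open ≡-Reasoning
    s₀ : ℤ
    s₀ = signℙ (x 0)
    M : Fin (suc n) → Fin (suc n) → ℤ
    M i j = signℙ (x (toℕ i + toℕ j))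
    swap : ∀ a b c → a *ℤ (b *ℤ c) ≡ b *ℤ (a *ℤ c)
    swap = solve-∀
    pos-^ : ∀ m → + (2 ^ m) ≡ (+ 2) ℤ.^ m
    pos-^ zero    = refl
    pos-^ (suc m) = trans (ℤₚ.pos-* 2 (2 ^ m)) (cong (+ 2 *ℤ_) (pos-^ m))
    entry : ∀ i j → schur (scaleRow₀ s₀ M) i j ≡ + 2 *ℤ core i j
    entry i j rewrite ℕₚ.+-identityʳ (toℕ i)
                    | signℙ-* (x 0) (x (suc (toℕ j)))
                    | signℙ-* (x (suc (toℕ i))) (x 0 ⊕ x (suc (toℕ j))) =
      signℙ-diff (x (suc (toℕ i + suc (toℕ j)))) (x (suc (toℕ i)) ⊕ (x 0 ⊕ x (suc (toℕ j))))

  coreℙ : ℕ → ℕ → Parity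
  coreℙ i j = x (suc (i + suc j)) ⊕ (x (suc i) ⊕ (x 0 ⊕ x (suc j)))

  ones : Series
  ones _ = 1ℙ

  -- The entries at (i+1, j) and (i, j+1) share the Hankel term x_{i+j+3}. What remains of their sum
  -- separates into v_i + v_j, as x₀ and x₁ cancel there; this is the `step` law for u with all
  -- coefficients 1.
  core-isBezoutian : IsBezoutian ones (coreℙ 0) coreℙ
  core-isBezoutian = record { row₀ = λ _ → refl ; col₀ = col₀ ; step = step }
    where
    open ℙ-Solver
    col₀ : ∀ i → coreℙ i 0 ≡ coreℙ 0 i
    col₀ i rewrite ℕₚ.+-comm i 1 =
      solve 4 (λ a b p q → q :+ (p :+ (a :+ b)) := q :+ (b :+ (a :+ p))) refl
        (x 0) (x 1) (x (suc i)) (x (suc (suc i)))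
    step : ∀ i j → coreℙ (suc i) j ≡ coreℙ i (suc j) ⊕ (coreℙ 0 i ⊗ 1ℙ ⊕ coreℙ 0 j)
    step i j rewrite ℕₚ.+-suc i (suc j) =
      solve 7 (λ a b p q p′ q′ r →
          r :+ (q :+ (a :+ p′)) :=
          r :+ (p :+ (a :+ q′)) :+ ((q :+ (b :+ (a :+ p))) :* con 1ℙ :+ (q′ :+ (b :+ (a :+ p′))))) refl
        (x 0) (x 1) (x (suc i)) (x (suc (suc i))) (x (suc j)) (x (suc (suc j))) (x (suc (suc (i + suc j))))

  -- Since (1 + t)(1 + t + t² + ⋯) = 1, the product (1 + t) u v is v. Hence q_{n+1} = v_n + v_{2n+2}
  -- + 1, in which x₀ and x₁ cancel.
  defect-core : ∀ n → defect ones (coreℙ 0) n ≡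
    1ℙ ⊕ (x n ⊕ x (suc (double n)) ⊕ (x (suc n) ⊕ x (suc (suc (double n)))))
  defect-core zero =
    solve 3 (λ a b c → (c :+ (b :+ (a :+ b))) :+ con 1ℙ := con 1ℙ :+ (a :+ b :+ (b :+ c))) refl (x 0) (x 1) (x 2)
    where open ℙ-Solver
  defect-core (suc n) =
    solve 7 (λ a b p q p′ q′ r →
        (q :+ (b :+ (a :+ p))) :+ ((q′ :+ (b :+ (a :+ p′))) :+ r :+ r) :+ con 1ℙ :=
        con 1ℙ :+ (p :+ p′ :+ (q :+ q′))) refl
      (x 0) (x 1) (x (suc n)) (x (suc (suc n)))
      (x (suc (double (suc n)))) (x (suc (suc (double (suc n)))))
      (conv ones (coreℙ 0) (suc (double n)))
    where open ℙ-Solver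

  -- Half of d_n + d_{n+1} - d_{2n+1} - d_{2n+2}, paired so that each difference of signs can be
  -- halved on its own.
  condition : ℕ → ℤ
  condition n = halfDiff (x n) (x (suc (double n))) +ℤ halfDiff (x (suc n)) (x (suc (suc (double n))))

  par-condition : ∀ n → par (condition n) ≡ 1ℙ ⊕ defect ones (coreℙ 0) n
  par-condition n = begin
    par (condition n)            ≡⟨ par-+ (halfDiff (x n) (x (suc (double n)))) _ ⟩
    _                            ≡⟨ cong₂ _⊕_ (par-halfDiff (x n) (x (suc (double n))))
                                              (par-halfDiff (x (suc n)) (x (suc (suc (double n))))) ⟩
    c                            ≡⟨ solve 1 (λ c → c := con 1ℙ :+ (con 1ℙ :+ c)) refl c ⟩
    1ℙ ⊕ (1ℙ ⊕ c)                ≡⟨ cong (1ℙ ⊕_) (defect-core n) ⟨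
    1ℙ ⊕ defect ones (coreℙ 0) n ∎
    where
    open ≡-Reasoning
    open ℙ-Solver
    c : Parity
    c = x n ⊕ x (suc (double n)) ⊕ (x (suc n) ⊕ x (suc (suc (double n))))

  par-det-core : ∀ n → (∀ i → i < n → par (condition i) ≡ 1ℙ) → par (det (suc n) core) ≡ par (condition n)
  par-det-core n conds =
    trans (det-bezoutian n {core} core-parity core-isBezoutian refl λ i i<n →
            1⊕p≡1⇒p≡0 _ (trans (sym (par-condition i)) (conds i i<n)))
          (sym (par-condition n))
    where
    1⊕p≡1⇒p≡0 : ∀ p → 1ℙ ⊕ p ≡ 1ℙ → p ≡ 0ℙ
    1⊕p≡1⇒p≡0 0ℙ _ = refl
    core-parity : ∀ i j → par (core i j) ≡ coreℙ (toℕ i) (toℕ j)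
    core-parity i j = par-halfDiff (x (suc (toℕ i + suc (toℕ j)))) _

  -- `par-det-core` links order n + 1 to condition n once all earlier conditions hold. From right to
  -- left these are given; from left to right `below` recovers them recursively. Order 0 is the
  -- empty determinant 1.
  det-core-odd⇔condition-odd : (∀ n → par (det n core) ≡ 1ℙ) ⇔ (∀ n → par (condition n) ≡ 1ℙ)
  det-core-odd⇔condition-odd = mk⇔
    (λ odd n → trans (sym (par-det-core n (below odd n))) (odd (suc n)))
    (λ { cond zero → refl ; cond (suc n) → trans (par-det-core n (λ i _ → cond i)) (cond n) })
    where
    below : (∀ n → par (det n core) ≡ 1ℙ) → ∀ n i → i < n → par (condition i) ≡ 1ℙ
    below odd (suc n) i i<1+n with ℕₚ.m<1+n⇒m<n∨m≡n i<1+n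
    ... | inj₁ i<n  = below odd n i i<n
    ... | inj₂ refl = trans (sym (par-det-core n (below odd n))) (odd (suc n))

theorem1p1 : (d : ℕ → ℤ) → IsPM1Seq d →
    (Apwenian d ⇔ (∀ (n : ℕ) → OddMultipleOf2^ 1 (((d n +ℤ d (n + 1)) -ℤ d (2 * n + 1)) -ℤ d (2 * n + 2))))
-- The Hankel determinant of order m + 1 corresponds to `core` of order m, so condition n is
-- governed by Hankel order n + 2. The sign d₀ is odd and does not affect parity.
theorem1p1 d d-pm1 = mk⇔
  (λ apw n → subst (OddMultipleOf2^ 1) (sym (condition-value n))
               (from (oddMultiple⇔ 1 (condition n))
                 (to det-core-odd⇔condition-odd
                   (λ m → trans (sym (par-signed m))
                            (to (oddMultiple⇔ m _) (subst (OddMultipleOf2^ m) (hankel-value m) (apw m)))) n)))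
  (λ cond m → subst (OddMultipleOf2^ m) (sym (hankel-value m))
                (from (oddMultiple⇔ m _)
                  (trans (par-signed m)
                    (from det-core-odd⇔condition-odd
                      (λ n → to (oddMultiple⇔ 1 (condition n))
                               (subst (OddMultipleOf2^ 1) (condition-value n) (cond n))) m))))
  where
  open Equivalence
  x : Series
  x = proj₁ (signs d-pm1)
  d≗signs : ∀ n → d n ≡ signℙ (x n)
  d≗signs = proj₂ (signs d-pm1)
  open SignSequence x

  par-signed : ∀ m → par (signℙ (x 0) *ℤ det m core) ≡ par (det m core)
  par-signed m = trans (par-* (signℙ (x 0)) (det m core)) (cong (_⊗ par (det m core)) (par-signℙ (x 0)))

  hankel-value : ∀ m → hankel d (suc m) ≡ + (2 ^ m) *ℤ (signℙ (x 0) *ℤ det m core)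
  hankel-value m = trans (det-cong (suc m) λ i j → d≗signs (toℕ i + toℕ j)) (hankel-core m)

  regroup : ∀ a b p q → a +ℤ b -ℤ p -ℤ q ≡ (a -ℤ p) +ℤ (b -ℤ q)
  regroup = solve-∀

  condition-value : ∀ n → ((d n +ℤ d (n + 1)) -ℤ d (2 * n + 1)) -ℤ d (2 * n + 2) ≡ + (2 ^ 1) *ℤ condition n
  condition-value n
    rewrite sym (double≡2* n) | ℕₚ.+-comm n 1 | ℕₚ.+-comm (double n) 1 | ℕₚ.+-comm (double n) 2
          | d≗signs n | d≗signs (suc n) | d≗signs (suc (double n)) | d≗signs (suc (suc (double n)))
          | regroup (signℙ (x n)) (signℙ (x (suc n))) (signℙ (x (suc (double n)))) (signℙ (x (suc (suc (double n)))))
          | signℙ-diff (x n) (x (suc (double n)))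
          | signℙ-diff (x (suc n)) (x (suc (suc (double n))))
          = sym (ℤₚ.*-distribˡ-+ (+ 2) (halfDiff (x n) (x (suc (double n))))
                                       (halfDiff (x (suc n)) (x (suc (suc (double n))))))
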